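{- Each type composition $\widehat{n}=(n_1,\dots,n_t)\in\mathbb{N}_{>0}^t$ with $t\ge 6$ is non-weighted.
   Context: A simple game is a pair $(v,N)$ with $N$ a finite set (of agents) and $v:2^N\to\{0,1\}$ satisfying $v(\emptyset)=0$, $v(N)=1$, and $v(S)\le v(T)$ for all $S\subseteq T\subseteq N$. For agents $i,j$ write $i\sqsupset j$ if $v(\{i\}\cup S\setminus\{j\})\ge v(S)$ for all $\{j\}\subseteq S\subseteq N\setminus\{i\}$, and $i\,\square\, j$ if both $i\sqsupset j$ and $j\sqsupset i$. A simple game is complete if $\sqsupset$ is a total preorder (reflexive, total, transitive). The relation $\square$ partitions $N$ into equivalence classes $N_1,\dots,N_t$, numbered in order of decreasing desirability (agents in $N_1$ are the most desirable with respect to $\sqsupset$); $t$ is the number of types and $(n_1,\dots,n_t)\in\mathbb{N}_{>0}^t$ with $n_i=|N_i|$ is the type composition of the game. A simple game $(v,N)$ is weighted if there exist weights $w_i\in\mathbb{R}_{\ge 0}$ for $i\in N$ and a quota $q\in\mathbb{R}_{>0}$ such that, for all $S\subseteq N$, $v(S)=1$ if and only if $\sum_{i\in S}w_i\ge q$. A type composition $\widehat{n}\in\mathbb{N}_{>0}^t$ is called weighted if all complete simple games with type composition $\widehat{n}$ are weighted; otherwise (i.e. if some complete simple game with type composition $\widehat{n}$ is not weighted) it is called non-weighted. -}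

module Defs where

open import Algebra.Bundles using (module CommutativeMonoid)
import Algebra.Properties.CommutativeSemigroup as CommutativeSemigroup
open import Data.Bool.Base as Bool using (Bool; true; false; if_then_else_)
open import Data.Fin.Base as Fin using (Fin)
open import Data.Fin.Subset
  using (Subset; _∈_; _∉_; _⊆_; _∪_; _-_; ⁅_⁆; ∣_∣; ⊥; ⊤)
open import Data.Nat.Base as ℕ using (ℕ)
import Data.Nat.Properties as ℕ
open import Data.Product.Base using (∃-syntax; _×_; _,_)
open import Data.Rational.Base as ℚ using (ℚ; 0ℚ; 1ℚ; ½)
import Data.Rational.Properties as ℚ
open import Data.Vec.Base using (lookup)
open import Data.Vec.Functional as Vector using (Vector)
open import Function.Bundles using (_⇔_)
open import Relation.Binary.Core using (Rel)
open import Relation.Binary.PropositionalEquality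
  using (_≡_; subst; subst₂; cong; module ≡-Reasoning)
open import Relation.Binary.Structures using (IsTotalPreorder)
open import Relation.Nullary.Negation using (¬_)
open import Level using (0ℓ)

private
  variable
    k t : ℕ

-- The reals are Cauchy sequences of rationals. There is no quotient: two
-- sequences denote the same real when each is ≤ᵣ the other, and addition
-- and the two orders below respect this.

IsCauchy : (ℕ → ℚ) → Set
IsCauchy x = ∀ ε → 0ℚ ℚ.< ε →
  ∃[ N ] (∀ m n → N ℕ.≤ m → N ℕ.≤ n → ℚ.∣ x m ℚ.- x n ∣ ℚ.< ε)

record ℝ : Set where
  constructor mkℝ
  field
    seq      : ℕ → ℚ
    isCauchy : IsCauchy seq

open ℝ public

0ℝ : ℝ
0ℝ = mkℝ (λ _ → 0ℚ) (λ _ 0<ε → 0 , λ _ _ _ _ → 0<ε)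

+-isCauchy : ∀ x y → IsCauchy x → IsCauchy y → IsCauchy (λ n → x n ℚ.+ y n)
+-isCauchy x y cx cy ε 0<ε =
  let 0<ε/2    = subst (ℚ._< ½ ℚ.* ε) (ℚ.*-zeroʳ ½) (ℚ.*-monoʳ-<-pos ½ 0<ε)
      (M , px) = cx (½ ℚ.* ε) 0<ε/2
      (N , py) = cy (½ ℚ.* ε) 0<ε/2
  in M ℕ.⊔ N , λ m n M⊔N≤m M⊔N≤n →
    let dx = px m n (ℕ.≤-trans (ℕ.m≤m⊔n M N) M⊔N≤m) (ℕ.≤-trans (ℕ.m≤m⊔n M N) M⊔N≤n)
        dy = py m n (ℕ.≤-trans (ℕ.m≤n⊔m M N) M⊔N≤m) (ℕ.≤-trans (ℕ.m≤n⊔m M N) M⊔N≤n)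
    in subst₂ ℚ._<_
         (cong ℚ.∣_∣ (regroup (x m) (x n) (y m) (y n)))
         (halves ε)
         (ℚ.≤-<-trans (ℚ.∣p+q∣≤∣p∣+∣q∣ (x m ℚ.- x n) (y m ℚ.- y n))
                      (ℚ.+-mono-< dx dy))
  where
  open ≡-Reasoning
  open CommutativeSemigroup
    (CommutativeMonoid.commutativeSemigroup ℚ.+-0-commutativeMonoid)
    using (interchange)
  regroup : ∀ a b c d →
    (a ℚ.- b) ℚ.+ (c ℚ.- d) ≡ (a ℚ.+ c) ℚ.- (b ℚ.+ d)
  regroup a b c d = begin
    (a ℚ.- b) ℚ.+ (c ℚ.- d)              ≡⟨ interchange a (ℚ.- b) c (ℚ.- d) ⟩
    (a ℚ.+ c) ℚ.+ (ℚ.- b ℚ.+ ℚ.- d)      ≡⟨ cong ((a ℚ.+ c) ℚ.+_) (ℚ.neg-distrib-+ b d) ⟨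
    (a ℚ.+ c) ℚ.- (b ℚ.+ d)              ∎
  halves : ∀ p → ½ ℚ.* p ℚ.+ ½ ℚ.* p ≡ p
  halves p = begin
    ½ ℚ.* p ℚ.+ ½ ℚ.* p  ≡⟨ ℚ.*-distribʳ-+ p ½ ½ ⟨
    1ℚ ℚ.* p             ≡⟨ ℚ.*-identityˡ p ⟩
    p                    ∎

infixl 6 _+ᵣ_
infix  4 _≤ᵣ_ _<ᵣ_

_+ᵣ_ : ℝ → ℝ → ℝ
x +ᵣ y = mkℝ (λ n → seq x n ℚ.+ seq y n)
             (+-isCauchy (seq x) (seq y) (isCauchy x) (isCauchy y))

_≤ᵣ_ : ℝ → ℝ → Set
x ≤ᵣ y = ∀ ε → 0ℚ ℚ.< ε →
  ∃[ N ] (∀ n → N ℕ.≤ n → seq x n ℚ.≤ seq y n ℚ.+ ε)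

_<ᵣ_ : ℝ → ℝ → Set
x <ᵣ y = ∃[ ε ] 0ℚ ℚ.< ε ×
  ∃[ N ] (∀ n → N ℕ.≤ n → seq x n ℚ.+ ε ℚ.≤ seq y n)

∑[_]_ : Subset k → Vector ℝ k → ℝ
∑[ S ] w = Vector.foldr _+ᵣ_ 0ℝ (λ i → if lookup S i then w i else 0ℝ)

-- The agents are the elements of Fin k; false and true stand for the
-- values 0 and 1, and Bool._≤_ is the order false ≤ true.
record SimpleGame (k : ℕ) : Set where
  field
    v        : Subset k → Bool
    v-empty  : v ⊥ ≡ false
    v-full   : v ⊤ ≡ true
    monotone : ∀ {S T} → S ⊆ T → v S Bool.≤ v T

open SimpleGame public

module _ (G : SimpleGame k) where

  infix 4 _⊐_ _□_

  _⊐_ : Rel (Fin k) 0ℓ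
  i ⊐ j = ∀ S → j ∈ S → i ∉ S → v G S Bool.≤ v G (⁅ i ⁆ ∪ (S - j))

  _□_ : Rel (Fin k) 0ℓ
  i □ j = i ⊐ j × j ⊐ i

  IsComplete : Set
  IsComplete = IsTotalPreorder _≡_ _⊐_

  record IsWeighted : Set where
    field
      w        : Vector ℝ k
      q        : ℝ
      0≤w      : ∀ i → 0ℝ ≤ᵣ w i
      0<q      : 0ℝ <ᵣ q
      winning⇔ : ∀ S → v G S ≡ true ⇔ q ≤ᵣ ∑[ S ] w

  -- class c is the equivalence class N_c of _□_.
  record HasTypeComposition (n̂ : Vector ℕ t) : Set where
    field
      class      : Fin t → Subset k
      nonempty   : ∀ c → ∃[ i ] i ∈ class c
      cover      : ∀ i → ∃[ c ] i ∈ class c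
      isClass    : ∀ {c i} → i ∈ class c → ∀ j → j ∈ class c ⇔ i □ j
      decreasing : ∀ {c d i j} → c Fin.< d → i ∈ class c → j ∈ class d →
                   i ⊐ j × ¬ (j ⊐ i)
      sizes      : ∀ c → ∣ class c ∣ ≡ n̂ c

WeightedComposition : Vector ℕ t → Set
WeightedComposition n̂ = ∀ {k} (G : SimpleGame k) →
  IsComplete G → HasTypeComposition G n̂ → IsWeighted G

-- Classically the negation of WeightedComposition n̂; constructively the
-- existential form is the stronger one.
NonWeightedComposition : Vector ℕ t → Set
NonWeightedComposition n̂ = ∃[ k ] ∃[ G ]
  IsComplete {k} G × HasTypeComposition G n̂ × ¬ IsWeighted G

{-# OPTIONS --safe #-}

-- Give the agents natural weights, equal within a type and differing by at
-- least 2 between types, and let a coalition of weight x win iff q ≤ x and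
-- x ≢ 1 + q. Replacing a member by an agent of a better type raises the weight
-- by at least 2, which never jumps from a winning to a losing weight, so the
-- game is complete. It is not weighted once two winning coalitions, of weights
-- q and 2 + q, can trade members to become two losing ones of weight 1 + q.
-- Six types suffice for such a trade; further types are put on top, by turns
-- as agents who win alone and as agents so heavy that, in the trade, they are
-- members of all four coalitions.

module Submission where

open import Defs
open import Data.Nat.Base using (ℕ; _<_; _≤_)
open import Data.Fin.Base using (Fin)
open import Data.Vec.Functional using (Vector)

open import Algebra.Bundles using (CommutativeMonoid)
import Algebra.Properties.CommutativeMonoid.Sum as Sum
import Algebra.Properties.CommutativeSemigroup as CommutativeSemigroup
import Algebra.Solver.CommutativeMonoid as CommutativeMonoidSolver
open import Data.Bool.Base as Bool using (true; false; if_then_else_; f≤t; b≤b)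
import Data.Bool.Properties as Bool
open import Data.Fin.Base as Fin using (zero; suc)
import Data.Fin.Properties as Fin
open import Data.Fin.Subset
  using (Subset; inside; outside; _∈_; _∉_; _⊆_; _∪_; _─_; _-_; ⁅_⁆; ∣_∣; ⊥; ⊤; Nonempty)
open import Data.Fin.Subset.Properties
  using ( ∪-identityˡ; p─⊥≡p; p─q⊆p; ∉⊥; ⊆-max; x∈p∪q⁻; x∈p∪q⁺; x∈⁅x⁆; x∈⁅y⁆⇒x≡y
        ; drop-∷-⊆; anySubset?; _∈?_; nonempty?; Empty-unique; ∣⊥∣≡0)
import Data.Nat.Base as ℕ
open import Data.Nat.Base using (_≤′_; ≤′-refl; ≤′-step; z≤n; s≤s)
import Data.Nat.Properties as ℕ
open import Data.Product.Base using (_×_; _,_; ∃-syntax; proj₁; proj₂)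
open import Data.Rational.Base as ℚ using (ℚ; 0ℚ; ½)
import Data.Rational.Properties as ℚ
open import Data.Sum.Base as Sum⊎ using (_⊎_; inj₁; inj₂)
open import Data.Vec.Base using ([]; _∷_; lookup; here; there; tabulate)
open import Data.Vec.Properties using (lookup∘tabulate; []=⇒lookup; lookup⇒[]=)
import Data.Vec.Functional as Vector
open import Function.Base using (_∘_; id)
open import Function.Bundles using (mk⇔; Equivalence)
open import Function.Definitions using (Injective)
open import Level using (0ℓ)
open import Relation.Binary.PropositionalEquality
  using (_≡_; _≢_; refl; sym; trans; cong; cong₂; subst; subst₂; isEquivalence)
import Relation.Binary.Reasoning.Setoid as ≈-Reasoning
open import Relation.Nullary.Decidable
  using (Dec; yes; no; does; dec-true; dec-false; from-yes; ¬?; _×-dec_; _⊎-dec_; _→-dec_)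
open import Relation.Nullary.Negation using (¬_; contradiction)

private
  variable
    k t : ℕ

-- Trades between coalitions, and subset sums in a commutative monoid

-- A trading transform of length two, stated position by position so that sums over both pairs can
-- be compared term by term.
Trade : (S₁ S₂ T₁ T₂ : Subset t) → Set
Trade S₁ S₂ T₁ T₂ = ∀ i →
  (lookup S₁ i ≡ lookup T₁ i × lookup S₂ i ≡ lookup T₂ i) ⊎
  (lookup S₁ i ≡ lookup T₂ i × lookup S₂ i ≡ lookup T₁ i)

image : (Fin t → Fin k) → Subset t → Subset k
image g []            = ⊥
image g (inside  ∷ U) = ⁅ g zero ⁆ ∪ image (g ∘ suc) U
image g (outside ∷ U) = image (g ∘ suc) U

∈-image⁻ : ∀ (g : Fin t → Fin k) U {i} → i ∈ image g U → ∃[ c ] (c ∈ U × i ≡ g c)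
∈-image⁻ g [] i∈ = contradiction i∈ ∉⊥
∈-image⁻ g (inside ∷ U) i∈ with x∈p∪q⁻ ⁅ g zero ⁆ (image (g ∘ suc) U) i∈
... | inj₁ i∈⁅g0⁆ = zero , here , x∈⁅y⁆⇒x≡y _ i∈⁅g0⁆
... | inj₂ i∈gU   = let c , c∈U , i≡gc = ∈-image⁻ (g ∘ suc) U i∈gU
                    in suc c , there c∈U , i≡gc
∈-image⁻ g (outside ∷ U) i∈ =
  let c , c∈U , i≡gc = ∈-image⁻ (g ∘ suc) U i∈
  in suc c , there c∈U , i≡gc

-- The monoid is left open for two uses: the natural weights that define the game, and, at each
-- index of the Cauchy sequences, the rational approximations of real weights supposed to represent
-- it.
module SubsetSum (M : CommutativeMonoid 0ℓ 0ℓ) where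

  open CommutativeMonoid M
    renaming (Carrier to C; refl to ≈-refl; sym to ≈-sym; trans to ≈-trans)
  open Sum M using (sum; sum-cong-≋; ∑-distrib-+)
  open CommutativeSemigroup commutativeSemigroup using (x∙yz≈y∙xz)
  open ≈-Reasoning setoid

  restrict : Vector C k → Subset k → Vector C k
  restrict f S i = if lookup S i then f i else ε

  weight : Vector C k → Subset k → C
  weight f S = sum (restrict f S)

  weight-cong : ∀ {f g : Vector C k} → (∀ i → f i ≈ g i) → ∀ S → weight f S ≈ weight g S
  weight-cong {f = f} {g} f≈g S = sum-cong-≋ pointwise
    where
    pointwise : ∀ i → restrict f S i ≈ restrict g S i
    pointwise i with lookup S i
    ... | true  = f≈g i
    ... | false = ≈-refl

  weight-⊥ : ∀ (f : Vector C k) → weight f ⊥ ≈ ε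
  weight-⊥ {k = ℕ.zero}  f = ≈-refl
  weight-⊥ {k = ℕ.suc k} f = ≈-trans (identityˡ _) (weight-⊥ (f ∘ suc))

  weight-insert : ∀ (f : Vector C k) {i} S → i ∉ S → weight f (⁅ i ⁆ ∪ S) ≈ f i ∙ weight f S
  weight-insert f {zero} (inside  ∷ S) i∉S = contradiction here i∉S
  weight-insert f {zero} (outside ∷ S) i∉S = begin
    f zero ∙ weight (f ∘ suc) (⊥ ∪ S)  ≡⟨ cong (λ T → f zero ∙ weight (f ∘ suc) T) (∪-identityˡ S) ⟩
    f zero ∙ weight (f ∘ suc) S        ≈⟨ ∙-congˡ (identityˡ _) ⟨
    f zero ∙ (ε ∙ weight (f ∘ suc) S)  ∎
  weight-insert f {suc i} (b ∷ S) i∉S =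
    ≈-trans (∙-congˡ (weight-insert (f ∘ suc) S (i∉S ∘ there)))
            (x∙yz≈y∙xz _ _ _)

  weight-remove : ∀ (f : Vector C k) {i} S → i ∈ S → weight f S ≈ f i ∙ weight f (S - i)
  weight-remove f (_ ∷ S) here = begin
    f zero ∙ weight (f ∘ suc) S              ≡⟨ cong (λ T → f zero ∙ weight (f ∘ suc) T) (p─⊥≡p S) ⟨
    f zero ∙ weight (f ∘ suc) (S ─ ⊥)        ≈⟨ ∙-congˡ (identityˡ _) ⟨
    f zero ∙ (ε ∙ weight (f ∘ suc) (S ─ ⊥))  ∎
  weight-remove f (b ∷ S) (there i∈S) =
    ≈-trans (∙-congˡ (weight-remove (f ∘ suc) S i∈S)) (x∙yz≈y∙xz _ _ _)

  weight-image : ∀ (f : Vector C k) {g : Fin t → Fin k} → Injective _≡_ _≡_ g →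
                 ∀ U → weight f (image g U) ≈ weight (f ∘ g) U
  weight-image f g-inj [] = weight-⊥ f
  weight-image f {g} g-inj (inside ∷ U) =
    ≈-trans (weight-insert f (image (g ∘ suc) U) g0∉)
            (∙-congˡ (weight-image f (λ eq → Fin.suc-injective (g-inj eq)) U))
    where
    g0∉ : g zero ∉ image (g ∘ suc) U
    g0∉ g0∈ with ∈-image⁻ (g ∘ suc) U g0∈
    ... | c , _ , eq with () ← g-inj eq
  weight-image f g-inj (outside ∷ U) =
    ≈-trans (weight-image f (λ eq → Fin.suc-injective (g-inj eq)) U) (≈-sym (identityˡ _))

  weight-trade : ∀ (f : Vector C t) S₁ S₂ T₁ T₂ → Trade S₁ S₂ T₁ T₂ →
                 weight f S₁ ∙ weight f S₂ ≈ weight f T₁ ∙ weight f T₂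
  weight-trade f S₁ S₂ T₁ T₂ trade = begin
    weight f S₁ ∙ weight f S₂                    ≈⟨ ∑-distrib-+ (restrict f S₁) (restrict f S₂) ⟨
    sum (λ i → restrict f S₁ i ∙ restrict f S₂ i) ≈⟨ sum-cong-≋ pointwise ⟩
    sum (λ i → restrict f T₁ i ∙ restrict f T₂ i) ≈⟨ ∑-distrib-+ (restrict f T₁) (restrict f T₂) ⟩
    weight f T₁ ∙ weight f T₂                    ∎
    where
    pointwise : ∀ i → restrict f S₁ i ∙ restrict f S₂ i ≈ restrict f T₁ i ∙ restrict f T₂ i
    pointwise i with trade i
    ... | inj₁ (p , q) rewrite p | q = ≈-refl
    ... | inj₂ (p , q) rewrite p | q = comm _ _

-- Real weights under a trade

open SubsetSum ℚ.+-0-commutativeMonoid using ()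
  renaming (weight to weightℚ; weight-image to weightℚ-image; weight-trade to weightℚ-trade)

seq-∑ : ∀ (S : Subset k) w n → seq (∑[ S ] w) n ≡ weightℚ (λ i → seq (w i) n) S
seq-∑ []            w n = refl
seq-∑ (inside  ∷ S) w n = cong (seq (w zero) n ℚ.+_) (seq-∑ S (w ∘ suc) n)
seq-∑ (outside ∷ S) w n = cong (0ℚ ℚ.+_) (seq-∑ S (w ∘ suc) n)

-- Finite sums of reals are formed index by index, so a trade preserves each rational approximation
-- exactly and no error term arises.
∑-image-trade : ∀ (w : Vector ℝ k) {g : Fin t → Fin k} → Injective _≡_ _≡_ g →
  ∀ S₁ S₂ T₁ T₂ → Trade S₁ S₂ T₁ T₂ → ∀ n →
  seq (∑[ image g S₁ ] w +ᵣ ∑[ image g S₂ ] w) n ≡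
  seq (∑[ image g T₁ ] w +ᵣ ∑[ image g T₂ ] w) n
∑-image-trade w {g} g-inj S₁ S₂ T₁ T₂ trade n =
  trans (cong₂ ℚ._+_ (seq-∑-image S₁) (seq-∑-image S₂))
    (trans (weightℚ-trade (λ c → seq (w (g c)) n) S₁ S₂ T₁ T₂ trade)
      (sym (cong₂ ℚ._+_ (seq-∑-image T₁) (seq-∑-image T₂))))
  where
  seq-∑-image : ∀ U → seq (∑[ image g U ] w) n ≡ weightℚ (λ c → seq (w (g c)) n) U
  seq-∑-image U = trans (seq-∑ (image g U) w n) (weightℚ-image _ g-inj U)

+-cancelʳ-≤ : ∀ r {p q} → p ℚ.+ r ℚ.≤ q ℚ.+ r → p ℚ.≤ q
+-cancelʳ-≤ r p+r≤q+r = ℚ.≮⇒≥ λ q<p → ℚ.<-irrefl refl (ℚ.<-≤-trans (ℚ.+-monoˡ-< r q<p) p+r≤q+r)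

halve : ∀ {ε} → 0ℚ ℚ.< ε → ∃[ δ ] (0ℚ ℚ.< δ × δ ℚ.+ δ ≡ ε)
halve {ε} 0<ε =
  ½ ℚ.* ε ,
  subst (ℚ._< ½ ℚ.* ε) (ℚ.*-zeroʳ ½) (ℚ.*-monoʳ-<-pos ½ 0<ε) ,
  trans (sym (ℚ.*-distribʳ-+ ε ½ ½)) (ℚ.*-identityˡ ε)

p≤∣p∣ : ∀ p → p ℚ.≤ ℚ.∣ p ∣
p≤∣p∣ p with ℚ.≤-total 0ℚ p
... | inj₁ 0≤p = ℚ.≤-reflexive (sym (ℚ.0≤p⇒∣p∣≡p 0≤p))
... | inj₂ p≤0 = ℚ.≤-trans p≤0 (ℚ.0≤∣p∣ p)

∣p-q∣<r⇒p≤q+r : ∀ p q {r} → ℚ.∣ p ℚ.- q ∣ ℚ.< r → p ℚ.≤ q ℚ.+ r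
∣p-q∣<r⇒p≤q+r p q {r} d<r = subst (ℚ._≤ q ℚ.+ r) (cancel p q)
  (ℚ.+-monoʳ-≤ q (ℚ.≤-trans (p≤∣p∣ (p ℚ.- q)) (ℚ.<⇒≤ d<r)))
  where
  cancel : ∀ p q → q ℚ.+ (p ℚ.- q) ≡ p
  cancel p q = trans (ℚ.+-comm q (p ℚ.- q)) (trans (ℚ.+-assoc p (ℚ.- q) q)
    (trans (cong (p ℚ.+_) (ℚ.+-inverseˡ q)) (ℚ.+-identityʳ p)))

cauchy-≤ : ∀ x y {ε} → 0ℚ ℚ.< ε →
  ∃[ N ] (∀ m n → N ℕ.≤ m → N ℕ.≤ n →
    seq x m ℚ.≤ seq x n ℚ.+ ε × seq y m ℚ.≤ seq y n ℚ.+ ε)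
cauchy-≤ x y {ε} 0<ε with isCauchy x ε 0<ε | isCauchy y ε 0<ε
... | M , x-close | N , y-close = M ℕ.⊔ N , λ m n ≤m ≤n →
  ∣p-q∣<r⇒p≤q+r (seq x m) (seq x n)
    (x-close m n (ℕ.m⊔n≤o⇒m≤o M N ≤m) (ℕ.m⊔n≤o⇒m≤o M N ≤n)) ,
  ∣p-q∣<r⇒p≤q+r (seq y m) (seq y n)
    (y-close m n (ℕ.m⊔n≤o⇒n≤o M N ≤m) (ℕ.m⊔n≤o⇒n≤o M N ≤n))

-- Constructively ≤ᵣ is not total, but comparing one sufficiently late pair of
-- rational approximations decides which of x ≤ᵣ y and y ≤ᵣ x + ε to prove.
≰ᵣ⇒≥ᵣ : ∀ {x y} → ¬ (x ≤ᵣ y) → y ≤ᵣ x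
≰ᵣ⇒≥ᵣ {x} {y} x≰y ε 0<ε with halve 0<ε
... | _ , 0<2δ , refl with halve 0<2δ
... | δ , 0<δ , refl with cauchy-≤ x y 0<δ
... | K , close with seq y K ℚ.≤? seq x K ℚ.+ (δ ℚ.+ δ)
... | yes yK≤xK+2δ = K , λ n K≤n → begin
    seq y n                             ≤⟨ proj₂ (close n K K≤n ℕ.≤-refl) ⟩
    seq y K ℚ.+ δ                       ≤⟨ ℚ.+-monoˡ-≤ δ yK≤xK+2δ ⟩
    seq x K ℚ.+ (δ ℚ.+ δ) ℚ.+ δ         ≤⟨ ℚ.+-monoˡ-≤ δ (ℚ.+-monoˡ-≤ (δ ℚ.+ δ)
                                             (proj₁ (close K n ℕ.≤-refl K≤n))) ⟩
    seq x n ℚ.+ δ ℚ.+ (δ ℚ.+ δ) ℚ.+ δ   ≡⟨ solve 2 (λ p d →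
                                             ((p ⊕ d) ⊕ (d ⊕ d)) ⊕ d ⊜ p ⊕ ((d ⊕ d) ⊕ (d ⊕ d)))
                                             refl (seq x n) δ ⟩
    seq x n ℚ.+ (δ ℚ.+ δ ℚ.+ (δ ℚ.+ δ)) ∎
  where
  open ℚ.≤-Reasoning
  open CommutativeMonoidSolver ℚ.+-0-commutativeMonoid
... | no yK≰xK+2δ = contradiction x≤y x≰y
  where
  open ℚ.≤-Reasoning
  x+δ≤y+δ : ∀ n → K ℕ.≤ n → seq x n ℚ.+ δ ℚ.≤ seq y n ℚ.+ δ
  x+δ≤y+δ n K≤n = begin
    seq x n ℚ.+ δ          ≤⟨ ℚ.+-monoˡ-≤ δ (proj₁ (close n K K≤n ℕ.≤-refl)) ⟩
    seq x K ℚ.+ δ ℚ.+ δ    ≡⟨ ℚ.+-assoc (seq x K) δ δ ⟩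
    seq x K ℚ.+ (δ ℚ.+ δ)  ≤⟨ ℚ.<⇒≤ (ℚ.≰⇒> yK≰xK+2δ) ⟩
    seq y K                ≤⟨ proj₂ (close K n ℕ.≤-refl K≤n) ⟩
    seq y n ℚ.+ δ          ∎
  x≤y : x ≤ᵣ y
  x≤y ε′ 0<ε′ = K , λ n K≤n → begin
    seq x n          ≤⟨ +-cancelʳ-≤ δ (x+δ≤y+δ n K≤n) ⟩
    seq y n          ≡⟨ ℚ.+-identityʳ (seq y n) ⟨
    seq y n ℚ.+ 0ℚ   ≤⟨ ℚ.+-monoʳ-≤ (seq y n) (ℚ.<⇒≤ 0<ε′) ⟩
    seq y n ℚ.+ ε′   ∎

-- Two copies of `q` are at most `c + d = a + b`, hence at most `q + b`; cancel one `q`.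
≤ᵣ-exchange : ∀ {a b c d q} → (∀ n → seq (c +ᵣ d) n ≡ seq (a +ᵣ b) n) →
  q ≤ᵣ c → q ≤ᵣ d → a ≤ᵣ q → q ≤ᵣ b
≤ᵣ-exchange {a} {b} {c} {d} {q} c+d≡a+b q≤c q≤d a≤q ε 0<ε with halve 0<ε
... | _ , 0<2δ , refl with halve 0<2δ
-- Here `ε` is four times `δ`, spent as `2δ`, `δ` and `δ` on the three hypotheses.
... | δ , 0<δ , refl with q≤c (δ ℚ.+ δ) 0<2δ | q≤d δ 0<δ | a≤q δ 0<δ
... | L , q≤c+2δ | M , q≤d+δ | N , a≤q+δ = L ℕ.⊔ M ℕ.⊔ N , λ n L⊔M⊔N≤n →
  let L⊔M≤n = ℕ.m⊔n≤o⇒m≤o (L ℕ.⊔ M) N L⊔M⊔N≤n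
      qₙ≤cₙ = q≤c+2δ n (ℕ.m⊔n≤o⇒m≤o L M L⊔M≤n)
      qₙ≤dₙ = q≤d+δ n (ℕ.m⊔n≤o⇒n≤o L M L⊔M≤n)
      aₙ≤qₙ = a≤q+δ n (ℕ.m⊔n≤o⇒n≤o (L ℕ.⊔ M) N L⊔M⊔N≤n)
      aₙ = seq a n ; bₙ = seq b n ; cₙ = seq c n ; dₙ = seq d n ; qₙ = seq q n
  in +-cancelʳ-≤ (qₙ ℚ.+ aₙ) (begin
    qₙ ℚ.+ (qₙ ℚ.+ aₙ)                        ≤⟨ ℚ.+-mono-≤ qₙ≤cₙ (ℚ.+-mono-≤ qₙ≤dₙ aₙ≤qₙ) ⟩
    cₙ ℚ.+ (δ ℚ.+ δ) ℚ.+ (dₙ ℚ.+ δ ℚ.+ (qₙ ℚ.+ δ))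
      ≡⟨ solve 4 (λ c d q e →
           (c ⊕ (e ⊕ e)) ⊕ ((d ⊕ e) ⊕ (q ⊕ e)) ⊜ (c ⊕ d) ⊕ (q ⊕ ((e ⊕ e) ⊕ (e ⊕ e))))
           refl cₙ dₙ qₙ δ ⟩
    cₙ ℚ.+ dₙ ℚ.+ (qₙ ℚ.+ (δ ℚ.+ δ ℚ.+ (δ ℚ.+ δ)))
      ≡⟨ cong (ℚ._+ _) (c+d≡a+b n) ⟩
    aₙ ℚ.+ bₙ ℚ.+ (qₙ ℚ.+ (δ ℚ.+ δ ℚ.+ (δ ℚ.+ δ)))
      ≡⟨ solve 4 (λ a b q e → (a ⊕ b) ⊕ (q ⊕ e) ⊜ (b ⊕ e) ⊕ (q ⊕ a)) refl aₙ bₙ qₙ _ ⟩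
    bₙ ℚ.+ (δ ℚ.+ δ ℚ.+ (δ ℚ.+ δ)) ℚ.+ (qₙ ℚ.+ aₙ)  ∎)
  where
  open ℚ.≤-Reasoning
  open CommutativeMonoidSolver ℚ.+-0-commutativeMonoid

-- Winning weights and weight schemes

open CommutativeSemigroup ℕ.+-commutativeSemigroup using (x∙yz≈y∙xz)
open SubsetSum ℕ.+-0-commutativeMonoid
  using (weight; weight-cong; weight-⊥; weight-insert; weight-remove; weight-image)

Wins : ℕ → ℕ → Set
Wins q x = q ℕ.≤ x × x ≢ ℕ.suc q

wins? : ∀ q x → Dec (Wins q x)
wins? q x = q ℕ.≤? x ×-dec ¬? (x ℕ.≟ ℕ.suc q)

Wins-quota : ∀ q → Wins q q
Wins-quota q = ℕ.≤-refl , ℕ.<⇒≢ ℕ.≤-refl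

-- From `q ≤ x`, an increase by 2 or more lands at `2 + q` or above, past the excluded weight.
Wins-step : ∀ {q x y} → 2 ℕ.+ x ℕ.≤ y → Wins q x → Wins q y
Wins-step 2+x≤y (q≤x , _) =
  ℕ.≤-trans q≤x (ℕ.m+n≤o⇒n≤o 2 2+x≤y) ,
  λ { refl → ℕ.<-irrefl refl (ℕ.≤-trans (s≤s q≤x) (ℕ.≤-pred 2+x≤y)) }

Wins-shift : ∀ a {q x} → Wins q x → Wins (a ℕ.+ q) (a ℕ.+ x)
Wins-shift a {q} {x} (q≤x , x≢1+q) =
  ℕ.+-monoʳ-≤ a q≤x ,
  λ eq → x≢1+q (ℕ.+-cancelˡ-≡ a x (ℕ.suc q) (trans eq (sym (ℕ.+-suc a q))))

Wins-unshift : ∀ a {q x} → Wins (a ℕ.+ q) (a ℕ.+ x) → Wins q x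
Wins-unshift a {q} {x} (q≤x , x≢1+q) =
  ℕ.+-cancelˡ-≤ a q x q≤x ,
  λ { refl → x≢1+q (ℕ.+-suc a q) }

-- All subsets here are sets of types. The trade and the separations thus take at most one agent of
-- each type, beside the two agents compared in a separation, and are available for all positive
-- class sizes. The bound `F≤q` is an invariant that lets `addHeavy` choose its weight.
record Scheme (t : ℕ) : Set where
  field
    F    : Vector ℕ t
    q    : ℕ
    2≤q  : 2 ℕ.≤ q
    2≤F  : ∀ c → 2 ℕ.≤ F c
    F≤q  : ∀ c → F c ℕ.≤ q
    gap  : ∀ c d → c Fin.< d → 2 ℕ.+ F d ℕ.≤ F c
    S₁ S₂ T₁ T₂ : Subset t
    trade : Trade S₁ S₂ T₁ T₂
    weight-S₁ : weight F S₁ ≡ q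
    weight-S₂ : weight F S₂ ≡ 2 ℕ.+ q
    weight-T₁ : weight F T₁ ≡ 1 ℕ.+ q
    weight-T₂ : weight F T₂ ≡ 1 ℕ.+ q
    separate  : ∀ c d → c Fin.< d → ∃[ U ] c ∉ U × d ∉ U ×
                Wins q (F c ℕ.+ weight F U) × ¬ Wins q (F d ℕ.+ weight F U)

  -- Needed to separate d from a heavy type added on top: U wins with a heavy agent,
  -- and is too light to win with an agent of type d instead.
  Avoidable : Set
  Avoidable = ∀ d → ∃[ U ] d ∉ U × Wins q (weight F U) × weight F U ℕ.≤ 2 ℕ.+ q

  -- Leaves room for a type of weight `q` on top with the required gap.
  Bounded : Set
  Bounded = ∀ c → 2 ℕ.+ F c ℕ.≤ q

-- The weights were found by computer search.
sixTypes : Scheme 6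
sixTypes = record
  { F         = F
  ; q         = 37
  ; 2≤q       = from-yes (2 ℕ.≤? 37)
  ; 2≤F       = from-yes (Fin.all? λ c → 2 ℕ.≤? F c)
  ; F≤q       = from-yes (Fin.all? λ c → F c ℕ.≤? 37)
  ; gap       = from-yes (Fin.all? λ c → Fin.all? λ d →
                  (c Fin.<? d) →-dec (2 ℕ.+ F d ℕ.≤? F c))
  ; S₁        = S₁
  ; S₂        = S₂
  ; T₁        = T₁
  ; T₂        = T₂
  ; trade     = from-yes (Fin.all? λ c →
                  (lookup S₁ c Bool.≟ lookup T₁ c ×-dec lookup S₂ c Bool.≟ lookup T₂ c) ⊎-dec
                  (lookup S₁ c Bool.≟ lookup T₂ c ×-dec lookup S₂ c Bool.≟ lookup T₁ c))
  ; weight-S₁ = refl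
  ; weight-S₂ = refl
  ; weight-T₁ = refl
  ; weight-T₂ = refl
  ; separate  = from-yes (Fin.all? λ c → Fin.all? λ d → (c Fin.<? d) →-dec anySubset? λ U →
                  ¬? (c ∈? U) ×-dec ¬? (d ∈? U) ×-dec
                  wins? 37 (F c ℕ.+ weight F U) ×-dec ¬? (wins? 37 (F d ℕ.+ weight F U)))
  }
  where
  F : Vector ℕ 6
  F = lookup (20 ∷ 18 ∷ 16 ∷ 14 ∷ 5 ∷ 3 ∷ [])
  -- The four weights are 18 + 14 + 5 = 37, 20 + 16 + 3 = 39, 20 + 18 = 38 and 16 + 14 + 5 + 3 = 38;
  -- each type occurs once on either side of the trade.
  S₁ S₂ T₁ T₂ : Subset 6
  S₁ = outside ∷ inside  ∷ outside ∷ inside  ∷ inside  ∷ outside ∷ []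
  S₂ = inside  ∷ outside ∷ inside  ∷ outside ∷ outside ∷ inside  ∷ []
  T₁ = inside  ∷ inside  ∷ outside ∷ outside ∷ outside ∷ outside ∷ []
  T₂ = outside ∷ outside ∷ inside  ∷ inside  ∷ inside  ∷ inside  ∷ []

sixTypes-avoidable : Scheme.Avoidable sixTypes
sixTypes-avoidable = from-yes (Fin.all? λ d → anySubset? λ U →
  ¬? (d ∈? U) ×-dec wins? 37 (weight F U) ×-dec weight F U ℕ.≤? 39)
  where open Scheme sixTypes

-- Adding a type on top

-- The quota is kept, so an agent of the new weight `q` wins alone while every older agent alone
-- loses: the empty set separates them. The trade omits the new type.
addPasser : (σ : Scheme t) → Scheme.Bounded σ → Scheme (ℕ.suc t)
addPasser σ bounded = record
  { F         = F⁺
  ; q         = q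
  ; 2≤q       = 2≤q
  ; 2≤F       = λ { zero → 2≤q ; (suc c) → 2≤F c }
  ; F≤q       = λ { zero → ℕ.≤-refl ; (suc c) → F≤q c }
  ; gap       = λ { zero (suc d) _ → bounded d ; (suc c) (suc d) (s≤s c<d) → gap c d c<d }
  ; S₁        = outside ∷ S₁
  ; S₂        = outside ∷ S₂
  ; T₁        = outside ∷ T₁
  ; T₂        = outside ∷ T₂
  ; trade     = λ { zero → inj₁ (refl , refl) ; (suc c) → trade c }
  ; weight-S₁ = weight-S₁
  ; weight-S₂ = weight-S₂
  ; weight-T₁ = weight-T₁
  ; weight-T₂ = weight-T₂
  ; separate  = separate⁺
  }
  where
  open Scheme σ
  F⁺ = q Vector.∷ F
  separate⁺ : ∀ c d → c Fin.< d → ∃[ U ] c ∉ U × d ∉ U ×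
              Wins q (F⁺ c ℕ.+ weight F⁺ U) × ¬ Wins q (F⁺ d ℕ.+ weight F⁺ U)
  separate⁺ zero (suc d) _ = ⊥ , ∉⊥ , ∉⊥ ,
    subst (Wins q) (sym (+⊥ q)) (Wins-quota q) ,
    λ (q≤Fd+⊥ , _) → ℕ.<⇒≱ (ℕ.m+n≤o⇒n≤o 1 (bounded d)) (subst (q ℕ.≤_) (+⊥ (F d)) q≤Fd+⊥)
    where
    +⊥ : ∀ x → x ℕ.+ weight F⁺ ⊥ ≡ x
    +⊥ x = trans (cong (x ℕ.+_) (weight-⊥ F⁺)) (ℕ.+-identityʳ x)
  separate⁺ (suc c) (suc d) (s≤s c<d) =
    let U , c∉U , d∉U , win , lose = separate c d c<d
    in outside ∷ U , (λ { (there c∈U) → c∉U c∈U }) , (λ { (there d∈U) → d∉U d∈U }) , win , lose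

-- The passer is avoided by `S₁`, any other type by the passer alone; both have weight exactly `q`.
addPasser-avoidable : (σ : Scheme t) (bounded : Scheme.Bounded σ) →
  Scheme.Avoidable (addPasser σ bounded)
addPasser-avoidable σ _ zero =
  outside ∷ S₁ , (λ ()) ,
  subst (Wins q) (sym weight-S₁) (Wins-quota q) ,
  ℕ.≤-trans (ℕ.≤-reflexive weight-S₁) (ℕ.m≤n+m q 2)
  where open Scheme σ
addPasser-avoidable σ bounded (suc d) =
  inside ∷ ⊥ , (λ { (there d∈⊥) → ∉⊥ d∈⊥ }) ,
  subst (Wins q) (sym weight-passer) (Wins-quota q) ,
  ℕ.≤-trans (ℕ.≤-reflexive weight-passer) (ℕ.m≤n+m q 2)
  where
  open Scheme σ
  weight-passer : q ℕ.+ weight F ⊥ ≡ q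
  weight-passer = trans (cong (q ℕ.+_) (weight-⊥ F)) (ℕ.+-identityʳ q)

-- Weight and quota grow by the same `W`, so the coalitions with one heavy agent reproduce the old
-- scheme, including its trade and its separations.
addHeavy : (σ : Scheme t) → Scheme.Avoidable σ → Scheme (ℕ.suc t)
addHeavy σ avoidable = record
  { F         = F⁺
  ; q         = q⁺
  ; 2≤q       = ℕ.≤-trans 2≤q q≤q⁺
  ; 2≤F       = λ { zero → s≤s (s≤s z≤n) ; (suc c) → 2≤F c }
  ; F≤q       = λ { zero → ℕ.m≤m+n W q ; (suc c) → ℕ.≤-trans (F≤q c) q≤q⁺ }
  ; gap       = λ { zero (suc d) _ → s≤s (s≤s (ℕ.m≤n⇒m≤1+n (F≤q d)))
                  ; (suc c) (suc d) (s≤s c<d) → gap c d c<d }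
  ; S₁        = inside ∷ S₁
  ; S₂        = inside ∷ S₂
  ; T₁        = inside ∷ T₁
  ; T₂        = inside ∷ T₂
  ; trade     = λ { zero → inj₁ (refl , refl) ; (suc c) → trade c }
  ; weight-S₁ = cong (W ℕ.+_) weight-S₁
  ; weight-S₂ = trans (cong (W ℕ.+_) weight-S₂) (shift 2)
  ; weight-T₁ = trans (cong (W ℕ.+_) weight-T₁) (shift 1)
  ; weight-T₂ = trans (cong (W ℕ.+_) weight-T₂) (shift 1)
  ; separate  = separate⁺
  }
  where
  open Scheme σ
  -- With the constant 3, the largest weight `q + (2 + q)` that an older agent can reach with an
  -- avoiding set falls one short of `q⁺`.
  W  = 3 ℕ.+ q
  q⁺ = W ℕ.+ q
  F⁺ = W Vector.∷ F
  q≤q⁺ : q ℕ.≤ q⁺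
  q≤q⁺ = ℕ.m≤n+m q W
  shift : ∀ a → W ℕ.+ (a ℕ.+ q) ≡ a ℕ.+ q⁺
  shift a = x∙yz≈y∙xz W a q
  separate⁺ : ∀ c d → c Fin.< d → ∃[ U ] c ∉ U × d ∉ U ×
              Wins q⁺ (F⁺ c ℕ.+ weight F⁺ U) × ¬ Wins q⁺ (F⁺ d ℕ.+ weight F⁺ U)
  separate⁺ zero (suc d) _ =
    let U , d∉U , win , U≤2+q = avoidable d
    in outside ∷ U , (λ ()) , (λ { (there d∈U) → d∉U d∈U }) , Wins-shift W win ,
       λ (q⁺≤Fd+U , _) → ℕ.<⇒≱
         (ℕ.≤-<-trans (ℕ.+-mono-≤ (F≤q d) U≤2+q) (ℕ.≤-reflexive (cong ℕ.suc (x∙yz≈y∙xz q 2 q))))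
         q⁺≤Fd+U
  separate⁺ (suc c) (suc d) (s≤s c<d) =
    let U , c∉U , d∉U , win , lose = separate c d c<d
    in inside ∷ U , (λ { (there c∈U) → c∉U c∈U }) , (λ { (there d∈U) → d∉U d∈U }) ,
       subst (Wins q⁺) (x∙yz≈y∙xz W (F c) (weight F U)) (Wins-shift W win) ,
       λ win′ → lose (Wins-unshift W (subst (Wins q⁺) (x∙yz≈y∙xz (F d) W (weight F U)) win′))

-- The new quota exceeds the heavy weight by `q`, which is at least 2.
addHeavy-bounded : (σ : Scheme t) (avoidable : Scheme.Avoidable σ) →
  Scheme.Bounded (addHeavy σ avoidable)
addHeavy-bounded σ _ = λ
  { zero    → ℕ.≤-trans (ℕ.≤-reflexive (ℕ.+-comm 2 (3 ℕ.+ q))) (ℕ.+-monoʳ-≤ (3 ℕ.+ q) 2≤q)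
  ; (suc c) → ℕ.+-mono-≤ {2} (s≤s (s≤s z≤n)) (F≤q c) }
  where open Scheme σ

-- The disjunction makes the induction work: each property is what one extension requires and the
-- other provides.
scheme : 6 ≤′ t → ∃[ σ ] (Scheme.Avoidable {t} σ ⊎ Scheme.Bounded σ)
scheme ≤′-refl = sixTypes , inj₁ sixTypes-avoidable
scheme (≤′-step 6≤t) with scheme 6≤t
... | σ , inj₁ avoidable = addHeavy σ avoidable , inj₂ (addHeavy-bounded σ avoidable)
... | σ , inj₂ bounded   = addPasser σ bounded , inj₁ (addPasser-avoidable σ bounded)

-- Agents with prescribed class sizes, and monotonicity of weights

fiber : (Fin k → Fin t) → Fin t → Subset k
fiber τ c = tabulate (λ i → does (τ i Fin.≟ c))

∈-fiber⁺ : ∀ (τ : Fin k → Fin t) {c i} → τ i ≡ c → i ∈ fiber τ c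
∈-fiber⁺ τ {c} {i} τi≡c = lookup⇒[]= i _
  (trans (lookup∘tabulate _ i) (dec-true (τ i Fin.≟ c) τi≡c))

∈-fiber⁻ : ∀ (τ : Fin k → Fin t) {c i} → i ∈ fiber τ c → τ i ≡ c
∈-fiber⁻ τ {c} {i} i∈ with τ i Fin.≟ c | trans (sym (lookup∘tabulate (λ i → does (τ i Fin.≟ c)) i)) ([]=⇒lookup i∈)
... | yes τi≡c | _ = τi≡c
... | no _ | ()

∣S∣>0⇒Nonempty : ∀ (S : Subset k) → 0 ℕ.< ∣ S ∣ → Nonempty S
∣S∣>0⇒Nonempty {k} S 0<∣S∣ with nonempty? S
... | yes S≢∅ = S≢∅
... | no S≡∅ with refl ← Empty-unique S≡∅ = contradiction (subst (0 ℕ.<_) (∣⊥∣≡0 k) 0<∣S∣) λ ()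

typeAssignment : ∀ (n̂ : Vector ℕ t) → ∃[ k ] ∃[ τ ] (∀ c → ∣ fiber {k} τ c ∣ ≡ n̂ c)
typeAssignment {ℕ.zero}  n̂ = 0 , (λ ()) , λ ()
typeAssignment {ℕ.suc t} n̂ with typeAssignment (Vector.tail n̂)
... | k , τ , sizes =
  let k′ , τ′ , size₀ , sizes₊ = prepend (n̂ zero)
  in k′ , τ′ , λ { zero → size₀ ; (suc c) → sizes₊ c }
  where
  ∣∅∣≡0 : ∀ k → ∣ tabulate {n = k} (λ _ → outside) ∣ ≡ 0
  ∣∅∣≡0 ℕ.zero    = refl
  ∣∅∣≡0 (ℕ.suc k) = ∣∅∣≡0 k
  prepend : ∀ m → ∃[ k′ ] ∃[ τ′ ] (∣ fiber {k′} τ′ zero ∣ ≡ m) ×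
                                  (∀ c → ∣ fiber τ′ (suc c) ∣ ≡ n̂ (suc c))
  -- Every agent built so far moves one type down the ranking, which leaves type `zero` empty.
  prepend ℕ.zero    = k , suc ∘ τ , ∣∅∣≡0 k , sizes
  prepend (ℕ.suc m) =
    let k′ , τ′ , size₀ , sizes₊ = prepend m
    in ℕ.suc k′ , zero Vector.∷ τ′ , cong ℕ.suc size₀ , sizes₊

-- Each added member contributes at least 2, so an increase by exactly 1, the only one that could
-- turn a winning weight into a losing one, cannot occur.
weight-⊆ : ∀ {f : Vector ℕ k} → (∀ i → 2 ℕ.≤ f i) → ∀ {S T} → S ⊆ T →
           weight f S ≡ weight f T ⊎ 2 ℕ.+ weight f S ℕ.≤ weight f T
weight-⊆ 2≤f {[]} {[]} S⊆T = inj₁ refl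
weight-⊆ {f = f} 2≤f {inside ∷ S} {T} S⊆T with S⊆T here
weight-⊆ {f = f} 2≤f {inside ∷ S} {_ ∷ T} S⊆T | here = Sum⊎.map
  (cong (f zero ℕ.+_))
  (λ 2+S≤T → ℕ.≤-trans (ℕ.≤-reflexive (x∙yz≈y∙xz 2 (f zero) (weight (f ∘ suc) S)))
                   (ℕ.+-monoʳ-≤ (f zero) 2+S≤T))
  (weight-⊆ (2≤f ∘ suc) (drop-∷-⊆ S⊆T))
weight-⊆ {f = f} 2≤f {outside ∷ S} {inside ∷ T} S⊆T with weight-⊆ (2≤f ∘ suc) (drop-∷-⊆ S⊆T)
... | inj₁ eq = inj₂ (ℕ.+-mono-≤ (2≤f zero) (ℕ.≤-reflexive eq))
... | inj₂ 2+S≤T = inj₂ (ℕ.≤-trans 2+S≤T (ℕ.m≤n+m _ (f zero)))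
weight-⊆ {f = f} 2≤f {outside ∷ S} {outside ∷ T} S⊆T = weight-⊆ (2≤f ∘ suc) (drop-∷-⊆ S⊆T)

does-mono : ∀ {P Q : Set} (P? : Dec P) (Q? : Dec Q) → (P → Q) → does P? Bool.≤ does Q?
does-mono (yes p) (yes q) _ = b≤b
does-mono (yes p) (no ¬q) f = contradiction (f p) ¬q
does-mono (no _)  (yes _) _ = f≤t
does-mono (no _)  (no _)  _ = b≤b

does-mono⁻ : ∀ {P Q : Set} (P? : Dec P) (Q? : Dec Q) → does P? Bool.≤ does Q? → P → Q
does-mono⁻ (yes _) (yes q) _ _ = q
does-mono⁻ (no ¬p) _       _ p = contradiction p ¬p

-- The game of a scheme

module Game (σ : Scheme t) (τ : Fin k → Fin t)
            (rep : Fin t → Fin k) (τ∘rep : ∀ c → τ (rep c) ≡ c) where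

  open Scheme σ

  f : Vector ℕ k
  f i = F (τ i)

  rep-injective : Injective _≡_ _≡_ rep
  rep-injective {c} {d} eq = trans (sym (τ∘rep c)) (trans (cong τ eq) (τ∘rep d))

  weight-rep : ∀ U → weight f (image rep U) ≡ weight F U
  weight-rep U = trans (weight-image f rep-injective U) (weight-cong (cong F ∘ τ∘rep) U)

  ∉-rep : ∀ {U} i → τ i ∉ U → i ∉ image rep U
  ∉-rep {U} i τi∉U i∈ with ∈-image⁻ rep U i∈
  ... | c , c∈U , refl = τi∉U (subst (_∈ U) (sym (τ∘rep c)) c∈U)

  winning : Subset k → Set
  winning S = Wins q (weight f S)

  winning? : ∀ S → Dec (winning S)
  winning? S = wins? q (weight f S)

  winning-⊆ : ∀ S T → S ⊆ T → winning S → winning T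
  winning-⊆ S T S⊆T win with weight-⊆ {f = f} (2≤F ∘ τ) {S} {T} S⊆T
  ... | inj₁ eq    = subst (Wins q) eq win
  ... | inj₂ 2+S≤T = Wins-step 2+S≤T win

  winning-rep : ∀ U → Wins q (weight F U) → winning (image rep U)
  winning-rep U = subst (Wins q) (sym (weight-rep U))

  S₁-wins : Wins q (weight F S₁)
  S₁-wins = subst (Wins q) (sym weight-S₁) (Wins-quota q)

  S₂-wins : Wins q (weight F S₂)
  S₂-wins = subst (Wins q) (sym weight-S₂) (ℕ.m≤n+m q 2 , ℕ.>⇒≢ ℕ.≤-refl)

  game : SimpleGame k
  game = record
    { v        = λ S → does (winning? S)
    ; v-empty  = dec-false (winning? ⊥) λ (q≤0 , _) →
        contradiction (ℕ.≤-trans 2≤q (ℕ.≤-trans q≤0 (ℕ.≤-reflexive (weight-⊥ f)))) λ ()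
    ; v-full   = dec-true (winning? ⊤) (winning-⊆ (image rep S₁) ⊤ (⊆-max _) (winning-rep S₁ S₁-wins))
    ; monotone = λ {S} {T} S⊆T → does-mono (winning? S) (winning? T) (winning-⊆ S T S⊆T)
    }

  -- Both coalitions consist of `S - j` and one further agent, so their weights agree when the types
  -- do, and otherwise differ by a `gap`.
  ⊐⁺ : ∀ {i j} → τ i Fin.≤ τ j → _⊐_ game i j
  ⊐⁺ {i} {j} τi≤τj S j∈S i∉S =
    does-mono (winning? S) (winning? (⁅ i ⁆ ∪ (S - j))) λ win →
      subst (Wins q) (sym (weight-insert f (S - j) (i∉S ∘ p─q⊆p S ⁅ j ⁆)))
        (replace (τ i) (τ j) τi≤τj (subst (Wins q) (weight-remove f S j∈S) win))
    where
    replace : ∀ c d → c Fin.≤ d → ∀ {x} → Wins q (F d ℕ.+ x) → Wins q (F c ℕ.+ x)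
    replace c d c≤d {x} with c Fin.≟ d
    ... | yes refl = id
    ... | no c≢d   = Wins-step (ℕ.+-monoˡ-≤ x (gap c d (Fin.≤∧≢⇒< c≤d c≢d)))

  -- The separating set `U`, realised by representatives, wins with `i` and loses with `j`. Since
  -- `U` omits both types, this works even when `i` and `j` are not the chosen representatives.
  <⇒¬⊐ : ∀ {i j} → τ i Fin.< τ j → ¬ _⊐_ game j i
  <⇒¬⊐ {i} {j} τi<τj j⊐i with separate (τ i) (τ j) τi<τj
  ... | U , τi∉U , τj∉U , win , lose = lose
    (subst (Wins q) weight-T (does-mono⁻ (winning? S) (winning? T) (j⊐i S i∈S j∉S)
      (subst (Wins q) (sym weight-S) win)))
    where
    X = image rep U
    S = ⁅ i ⁆ ∪ X
    T = ⁅ j ⁆ ∪ (S - i)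
    i∈S : i ∈ S
    i∈S = x∈p∪q⁺ (inj₁ (x∈⁅x⁆ i))
    j∉S : j ∉ S
    j∉S j∈S with x∈p∪q⁻ ⁅ i ⁆ X j∈S
    ... | inj₁ j∈⁅i⁆ = Fin.<-irrefl (cong τ (sym (x∈⁅y⁆⇒x≡y i j∈⁅i⁆))) τi<τj
    ... | inj₂ j∈X   = ∉-rep j τj∉U j∈X
    weight-S : weight f S ≡ f i ℕ.+ weight F U
    weight-S = trans (weight-insert f X (∉-rep i τi∉U)) (cong (f i ℕ.+_) (weight-rep U))
    weight-T : weight f T ≡ f j ℕ.+ weight F U
    weight-T = trans (weight-insert f (S - i) (j∉S ∘ p─q⊆p S ⁅ i ⁆))
      -- The weight of `S - i` comes from cancelling `f i` in that of `S`, without identifying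
      -- `S - i` with `X`.
      (cong (f j ℕ.+_) (ℕ.+-cancelˡ-≡ (f i) _ _ (trans (sym (weight-remove f S i∈S)) weight-S)))

  -- Together with `⊐⁺` this identifies desirability with the order of types, from which
  -- completeness and the classes are inherited.
  ⊐⁻ : ∀ {i j} → _⊐_ game i j → τ i Fin.≤ τ j
  ⊐⁻ i⊐j = ℕ.≮⇒≥ λ τj<τi → <⇒¬⊐ τj<τi i⊐j

  complete : IsComplete game
  complete = record
    { isPreorder = record
      { isEquivalence = isEquivalence
      ; reflexive     = λ { {i} refl → ⊐⁺ {i} {i} ℕ.≤-refl }
      ; trans         = λ {i} {j} {l} i⊐j j⊐l → ⊐⁺ {i} {l} (ℕ.≤-trans (⊐⁻ i⊐j) (⊐⁻ j⊐l))
      }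
    ; total = λ i j → Sum⊎.map ⊐⁺ ⊐⁺ (Fin.≤-total (τ i) (τ j))
    }

  hasTypeComposition : ∀ {n̂} → (∀ c → ∣ fiber τ c ∣ ≡ n̂ c) → HasTypeComposition game n̂
  hasTypeComposition sizes = record
    { class      = fiber τ
    ; nonempty   = λ c → rep c , ∈-fiber⁺ τ (τ∘rep c)
    ; cover      = λ i → τ i , ∈-fiber⁺ τ refl
    ; isClass    = λ {c} {i} i∈c j → mk⇔
        (λ j∈c → let τi≡τj = trans (∈-fiber⁻ τ i∈c) (sym (∈-fiber⁻ τ j∈c))
                 in ⊐⁺ (Fin.≤-reflexive τi≡τj) , ⊐⁺ (Fin.≤-reflexive (sym τi≡τj)))
        (λ (i⊐j , j⊐i) → ∈-fiber⁺ τ (trans (Fin.≤-antisym (⊐⁻ j⊐i) (⊐⁻ i⊐j)) (∈-fiber⁻ τ i∈c)))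
    ; decreasing = λ {c} {d} {i} {j} c<d i∈c j∈d →
        let τi<τj = subst₂ Fin._<_ (sym (∈-fiber⁻ τ i∈c)) (sym (∈-fiber⁻ τ j∈d)) c<d
        in ⊐⁺ (ℕ.<⇒≤ τi<τj) , <⇒¬⊐ τi<τj
    ; sizes      = sizes
    }

  -- As `T₁` loses, its real weight is at most the quota. The winning `S₁` and `S₂` have the same
  -- total as `T₁` and `T₂`, so `T₂` would have to reach the quota, although it loses.
  notWeighted : ¬ IsWeighted game
  notWeighted weighted = ¬reaches T₂ weight-T₂
    (≤ᵣ-exchange {total T₁} {total T₂} {total S₁} {total S₂} {quota}
      (∑-image-trade w rep-injective S₁ S₂ T₁ T₂ trade)
      (reaches S₁ S₁-wins) (reaches S₂ S₂-wins)
      (≰ᵣ⇒≥ᵣ {quota} {total T₁} (¬reaches T₁ weight-T₁)))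
    where
    open IsWeighted weighted renaming (q to quota)
    total : Subset t → ℝ
    total U = ∑[ image rep U ] w
    reaches : ∀ U → Wins q (weight F U) → quota ≤ᵣ total U
    reaches U win = Equivalence.to (winning⇔ (image rep U)) (dec-true (winning? (image rep U)) (winning-rep U win))
    ¬reaches : ∀ U → weight F U ≡ 1 ℕ.+ q → ¬ quota ≤ᵣ total U
    ¬reaches U eq quota≤U = contradiction
      (trans (sym (Equivalence.from (winning⇔ (image rep U)) quota≤U))
             (dec-false (winning? (image rep U)) λ (_ , ≢1+q) → ≢1+q (trans (weight-rep U) eq)))
      λ ()

lemma4 : ∀ (t : ℕ) → 6 ≤ t → (n̂ : Vector ℕ t) → (∀ (i : Fin t) → 0 < n̂ i) →
    NonWeightedComposition n̂
lemma4 t 6≤t n̂ 0<n̂ with typeAssignment n̂ | scheme (ℕ.≤⇒≤′ 6≤t)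
... | k , τ , sizes | σ , _ = k , game , complete , hasTypeComposition sizes , notWeighted
  where
  -- Positivity of `n̂` supplies the representative of each type.
  member : ∀ c → Nonempty (fiber τ c)
  member c = ∣S∣>0⇒Nonempty (fiber τ c) (subst (0 ℕ.<_) (sym (sizes c)) (0<n̂ c))
  open Game σ τ (proj₁ ∘ member) (λ c → ∈-fiber⁻ τ (proj₂ (member c)))
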